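{- Let $n,r,m\ge 0$ be integers, and for an integer $\ell\geq 0$ put $N_r=N_r(\ell)=\min\{n+r+1,\;m+r-\ell\}$. Then, as polynomials in $x,y$: (1) for every integer $\ell$ with $0\le \ell\le m$, $$\sum_{k=0}^{N_r(\ell)}\det\begin{pmatrix} M_{n,k}(x,y) & M_{m,k+\ell+1}(x,y)\\ M_{n+r+1,k}(x,y) & M_{m+r+1,k+\ell+1}(x,y)\end{pmatrix}=\sum_{i=0}^{r} M_{n+i,0}(x,y)\,M_{m+r-i,\ell}(y,y);$$ (2) $$\sum_{\ell=0}^{m+r}\ \sum_{k=0}^{N_r(\ell)}\det\begin{pmatrix} M_{n,k}(x,y) & M_{m,k+\ell+1}(x,y)\\ M_{n+r+1,k}(x,y) & M_{m+r+1,k+\ell+1}(x,y)\end{pmatrix}=\sum_{i=0}^{r} M_{n+i,0}(x,y)\,M_{m+r-i,0}(y+1,y).$$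
   Context: A partial Motzkin path from $(0,0)$ to $(n,k)$ is a lattice path that never goes below the $X$-axis and consists of up steps $U=(1,1)$, down steps $D=(1,-1)$ and horizontal steps $H=(1,0)$. In a weighted partial Motzkin path, every up step and every down step has weight $1$, every horizontal step lying on the $X$-axis has weight $x$, and every horizontal step not lying on the $X$-axis has weight $y$; the weight of a path is the product of the weights of its steps. $M_{n,k}(x,y)$ is the sum of the weights of all partial Motzkin paths from $(0,0)$ to $(n,k)$. Equivalently, $M_{0,0}(x,y)=1$, $M_{n,k}(x,y)=0$ if $n<k$ or $k<0$, $M_{n,0}(x,y)=xM_{n-1,0}(x,y)+M_{n-1,1}(x,y)$ for $n\ge1$, and $M_{n,k}(x,y)=M_{n-1,k-1}(x,y)+yM_{n-1,k}(x,y)+M_{n-1,k+1}(x,y)$ for $n\ge k\ge 1$. $M_{n,k}(y,y)$ and $M_{n,k}(y+1,y)$ denote the polynomials obtained by substituting $x=y$ and $x=y+1$, respectively. -}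

module Defs where

open import Algebra.Bundles using (CommutativeRing)
open import Data.Fin.Base using (toℕ)
open import Data.List.Base using (List; []; _∷_; [_]; _++_; map; foldr)
open import Data.List.Membership.Propositional using (_∈_)
open import Data.List.Membership.Propositional.Properties
  using (∈-map⁺; ∈-map⁻; ∈-++⁺ˡ; ∈-++⁺ʳ; ∈-++⁻)
open import Data.List.Relation.Binary.Disjoint.Propositional using (Disjoint)
open import Data.List.Relation.Unary.All using ([])
open import Data.List.Relation.Unary.AllPairs using ([]; _∷_)
open import Data.List.Relation.Unary.Any using (here)
open import Data.List.Relation.Unary.Unique.Propositional using (Unique)
import Data.List.Relation.Unary.Unique.Propositional.Properties as Unique
open import Data.Nat.Base as ℕ using (ℕ; zero; suc; _⊓_; _∸_)
open import Data.Product.Base using (_,_)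
open import Data.Sum.Base using ([_,_]′)
open import Relation.Binary.PropositionalEquality using (_≢_; refl)

-- Path n k is the type of partial Motzkin paths from (0,0) to (n,k), with the
-- last step outermost.  Heights are natural numbers, so a path cannot go below
-- the X-axis.
data Path : ℕ → ℕ → Set where
  start : Path 0 0
  U     : ∀ {n k} → Path n k       → Path (suc n) (suc k)
  D     : ∀ {n k} → Path n (suc k) → Path (suc n) k
  H     : ∀ {n k} → Path n k       → Path (suc n) k

paths : ∀ n k → List (Path n k)
paths zero    zero    = [ start ]
paths zero    (suc k) = []
paths (suc n) zero    = map H (paths n 0) ++ map D (paths n 1)
paths (suc n) (suc k) =
  map U (paths n k) ++ map H (paths n (suc k)) ++ map D (paths n (suc (suc k)))

-- The list contains every path exactly once, so a sum over it is a sum over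
-- all paths.
paths-complete : ∀ {n k} (p : Path n k) → p ∈ paths n k
paths-complete start = here refl
paths-complete {suc n} {suc k} (U p) = ∈-++⁺ˡ (∈-map⁺ U (paths-complete p))
paths-complete {suc n} {zero}  (D p) =
  ∈-++⁺ʳ (map H (paths n 0)) (∈-map⁺ D (paths-complete p))
paths-complete {suc n} {suc k} (D p) =
  ∈-++⁺ʳ (map U (paths n k))
    (∈-++⁺ʳ (map H (paths n (suc k))) (∈-map⁺ D (paths-complete p)))
paths-complete {suc n} {zero}  (H p) = ∈-++⁺ˡ (∈-map⁺ H (paths-complete p))
paths-complete {suc n} {suc k} (H p) =
  ∈-++⁺ʳ (map U (paths n k)) (∈-++⁺ˡ (∈-map⁺ H (paths-complete p)))

map-disjoint : ∀ {A B C : Set} {f : A → C} {g : B → C} →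
               (∀ {p q} → f p ≢ g q) → ∀ {ps qs} → Disjoint (map f ps) (map g qs)
map-disjoint f≢g (r∈f , r∈g) with ∈-map⁻ _ r∈f | ∈-map⁻ _ r∈g
... | _ , _ , refl | _ , _ , eq = f≢g eq

paths-unique : ∀ n k → Unique (paths n k)
paths-unique zero    zero    = [] ∷ []
paths-unique zero    (suc k) = []
paths-unique (suc n) zero    =
  Unique.++⁺ (Unique.map⁺ (λ { refl → refl }) (paths-unique n 0))
             (Unique.map⁺ (λ { refl → refl }) (paths-unique n 1))
             (map-disjoint λ ())
paths-unique (suc n) (suc k) =
  Unique.++⁺ (Unique.map⁺ (λ { refl → refl }) (paths-unique n k))
    (Unique.++⁺ (Unique.map⁺ (λ { refl → refl }) (paths-unique n (suc k)))
                (Unique.map⁺ (λ { refl → refl }) (paths-unique n (suc (suc k))))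
                (map-disjoint λ ()))
    λ (p∈U , p∈HD) → [ (λ p∈H → map-disjoint (λ ()) (p∈U , p∈H))
                     , (λ p∈D → map-disjoint (λ ()) (p∈U , p∈D))
                     ]′ (∈-++⁻ (map H (paths n (suc k))) p∈HD)

-- N_r(ℓ) = min {n + r + 1, m + r - ℓ}, only used for ℓ ≤ m + r, where _∸_ is
-- the true difference.
N : (n m r ℓ : ℕ) → ℕ
N n m r ℓ = (n ℕ.+ r ℕ.+ 1) ⊓ ((m ℕ.+ r) ∸ ℓ)

module Motzkin {c ℓ} (R : CommutativeRing c ℓ) where
  open CommutativeRing R
  open import Algebra.Properties.CommutativeMonoid.Sum +-commutativeMonoid
    using (sum-syntax)

  weight : (x y : Carrier) → ∀ {n k} → Path n k → Carrier
  weight x y start             = 1#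
  weight x y (U p)             = weight x y p * 1#
  weight x y (D p)             = weight x y p * 1#
  weight x y (H {k = zero}  p) = weight x y p * x
  weight x y (H {k = suc _} p) = weight x y p * y

  -- The value at (x , y) of the polynomial M_{n,k}; the polynomial itself is
  -- the case R = ℤ[x,y] with x and y the indeterminates.
  M : (n k : ℕ) (x y : Carrier) → Carrier
  M n k x y = foldr _+_ 0# (map (weight x y) (paths n k))

  -- Unlike the library's ∑[ i < n ], the upper limit is included, and the
  -- index is a natural number.
  ∑≤ : ℕ → (ℕ → Carrier) → Carrier
  ∑≤ n f = ∑[ i < suc n ] f (toℕ i)

  syntax ∑≤ n (λ i → t) = ∑[ i ≤ n ] t

  -- det₂ a b c d is the determinant of the matrix with rows (a , b), (c , d).
  det₂ : (a b c d : Carrier) → Carrier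
  det₂ a b c d = a * d - b * c

{-# OPTIONS --safe #-}

-- The numbers M n k satisfy a symmetric three-term recurrence in k, up to a
-- boundary term at k = 0.  As for a Wronskian (or Christoffel–Darboux kernel),
-- this turns the determinant for r = 0 into a difference c k - c (k + 1), and
-- the sum over k collapses to c 0 = M p 0 (x , y) * M q ℓ (y , y).  The
-- determinant for general r is a telescoping sum of determinants for r = 0.
-- The second identity follows from the first since
-- M q ℓ (y , y) = M q ℓ (y + 1 , y) - M q (ℓ + 1) (y + 1 , y) also telescopes.

module Submission where

open import Defs
open import Algebra.Bundles using (CommutativeRing)
open import Data.Fin.Base using (toℕ)
open import Data.Fin.Properties using (toℕ≤pred[n])
open import Data.List.Base using (List; []; _∷_; _++_; map; foldr)
open import Data.Nat.Base as ℕ using (ℕ; zero; suc; _≤_; _<_; _∸_; z≤n; s≤s)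
import Data.Nat.Properties as ℕ
open import Data.Product.Base using (_×_; _,_)
open import Data.Sum.Base using (inj₁; inj₂)
open import Function.Base using (_∘_)
open import Relation.Binary.PropositionalEquality as ≡ using (_≡_)
open import Relation.Nullary.Negation using (contradiction)

height≤length : ∀ {n k} → Path n k → k ≤ n
height≤length start = z≤n
height≤length (U p) = s≤s (height≤length p)
height≤length (D p) = ℕ.≤-trans (ℕ.n≤1+n _) (ℕ.m≤n⇒m≤1+n (height≤length p))
height≤length (H p) = ℕ.m≤n⇒m≤1+n (height≤length p)

module MotzkinProperties {a b} (R : CommutativeRing a b) where
  open CommutativeRing R
  open Motzkin R
  open import Algebra.Properties.Group +-group using (//-rightDividesˡ; //-rightDividesʳ)
  open import Algebra.Properties.Semiring.Sum semiring
    using (∑-comm; sum-cong-≋; sum-replicate-zero; *-distribˡ-sum)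
  open import Algebra.Solver.Ring.NaturalCoefficients.Default commutativeSemiring
    using (solve; _:=_; _:+_; _:*_)
  open import Relation.Binary.Reasoning.Setoid setoid

  -- Differences and finite sums.

  x≈z+y⇒x-y≈z : ∀ {x y z} → x ≈ z + y → x - y ≈ z
  x≈z+y⇒x-y≈z {x} {y} {z} eq = trans (+-congʳ eq) (//-rightDividesʳ y z)

  -- The solver works in commutative semirings, so an equation between differences is first brought
  -- to this additive form; negated terms that remain enter it as atoms.
  x+w≈z+y⇒x-y≈z-w : ∀ {x y z w} → x + w ≈ z + y → x - y ≈ z - w
  x+w≈z+y⇒x-y≈z-w {x} {y} {z} {w} eq = x≈z+y⇒x-y≈z (begin
    x                ≈⟨ //-rightDividesʳ w x ⟨
    x + w - w        ≈⟨ +-congʳ eq ⟩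
    z + y - w        ≈⟨ solve 3 (λ z y v → (z :+ y) :+ v := (z :+ v) :+ y) refl z y (- w) ⟩
    z - w + y        ∎)

  [w-x]-[y-z]≈[w+z]-[x+y] : ∀ w x y z → (w - x) - (y - z) ≈ (w + z) - (x + y)
  [w-x]-[y-z]≈[w+z]-[x+y] w x y z = x+w≈z+y⇒x-y≈z-w (begin
    w - x + (x + y)            ≈⟨ solve 4 (λ w x y v → (w :+ v) :+ (x :+ y) := ((w :+ v) :+ x) :+ y) refl w x y (- x) ⟩
    w - x + x + y              ≈⟨ +-cong (//-rightDividesˡ x w) (sym (//-rightDividesˡ z y)) ⟩
    w + (y - z + z)            ≈⟨ solve 3 (λ w u z → w :+ (u :+ z) := (w :+ z) :+ u) refl w (y - z) z ⟩
    w + z + (y - z)            ∎)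

  ∑≤-cong : ∀ n {f g : ℕ → Carrier} → (∀ k → k ≤ n → f k ≈ g k) → ∑≤ n f ≈ ∑≤ n g
  ∑≤-cong n f≈g = sum-cong-≋ {suc n} (λ i → f≈g (toℕ i) (toℕ≤pred[n] i))

  ∑≤-comm : ∀ m n (f : ℕ → ℕ → Carrier) →
            ∑[ i ≤ m ] ∑[ j ≤ n ] f i j ≈ ∑[ j ≤ n ] ∑[ i ≤ m ] f i j
  ∑≤-comm m n f = ∑-comm {suc m} {suc n} (λ i j → f (toℕ i) (toℕ j))

  ∑≤-telescope : ∀ n (f : ℕ → Carrier) → ∑[ k ≤ n ] (f k - f (suc k)) ≈ f 0 - f (suc n)
  ∑≤-telescope zero    f = +-identityʳ _
  ∑≤-telescope (suc n) f = begin
    f 0 - f 1 + ∑[ k ≤ n ] (f (suc k) - f (suc (suc k))) ≈⟨ +-congˡ (∑≤-telescope n (f ∘ suc)) ⟩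
    f 0 - f 1 + (f 1 - f (suc (suc n)))                  ≈⟨ +-assoc _ _ _ ⟨
    f 0 - f 1 + f 1 - f (suc (suc n))                    ≈⟨ +-congʳ (//-rightDividesˡ (f 1) (f 0)) ⟩
    f 0 - f (suc (suc n))                                ∎

  ∑≤-truncate : ∀ {m n} {f : ℕ → Carrier} → m ≤ n → (∀ k → m < k → f k ≈ 0#) → ∑≤ n f ≈ ∑≤ m f
  ∑≤-truncate {n = n} z≤n f≈0 = +-congˡ
    (trans (sum-cong-≋ {n} (λ i → f≈0 (suc (toℕ i)) (s≤s z≤n))) (sum-replicate-zero n))
  ∑≤-truncate (s≤s m≤n) f≈0 = +-congˡ (∑≤-truncate m≤n (λ k m<k → f≈0 (suc k) (s≤s m<k)))

  -- Recurrences for `M` and the change of axis weight.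

  module _ {A : Set} (w : A → Carrier) where
    total : List A → Carrier
    total ps = foldr _+_ 0# (map w ps)

    total-++ : ∀ ps qs → total (ps ++ qs) ≈ total ps + total qs
    total-++ []       qs = sym (+-identityˡ _)
    total-++ (p ∷ ps) qs = trans (+-congˡ (total-++ ps qs)) (sym (+-assoc _ _ _))

  total-map : ∀ {A B : Set} {v : A → Carrier} {w : B → Carrier} {g : A → B} {z} →
              (∀ p → w (g p) ≈ v p * z) → ∀ ps → total w (map g ps) ≈ total v ps * z
  total-map scale []       = sym (zeroˡ _)
  total-map scale (p ∷ ps) = trans (+-cong (scale p) (total-map scale ps)) (sym (distribʳ _ _ _))

  M-vanishes : ∀ {n k} x y → n < k → M n k x y ≈ 0#
  M-vanishes {n} {k} x y n<k with paths n k
  ... | []    = refl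
  ... | p ∷ _ = contradiction (height≤length p) (ℕ.<⇒≱ n<k)

  M-suc-zero : ∀ n x y → M (suc n) 0 x y ≈ x * M n 0 x y + M n 1 x y
  M-suc-zero n x y = begin
    M (suc n) 0 x y
      ≈⟨ total-++ (weight x y) (map H (paths n 0)) (map D (paths n 1)) ⟩
    total (weight x y) (map H (paths n 0)) + total (weight x y) (map D (paths n 1))
      ≈⟨ +-cong (total-map (λ _ → refl) (paths n 0)) (total-map (λ _ → refl) (paths n 1)) ⟩
    M n 0 x y * x + M n 1 x y * 1#
      ≈⟨ +-cong (*-comm _ _) (*-identityʳ _) ⟩
    x * M n 0 x y + M n 1 x y ∎

  M-suc-suc : ∀ n k x y →
              M (suc n) (suc k) x y ≈ M n k x y + y * M n (suc k) x y + M n (suc (suc k)) x y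
  M-suc-suc n k x y = begin
    M (suc n) (suc k) x y
      ≈⟨ total-++ w (map U (paths n k)) _ ⟩
    total w (map U (paths n k)) + total w (map H (paths n (suc k)) ++ map D (paths n (suc (suc k))))
      ≈⟨ +-congˡ (total-++ w (map H (paths n (suc k))) _) ⟩
    total w (map U (paths n k)) + (total w (map H (paths n (suc k))) + total w (map D (paths n (suc (suc k)))))
      ≈⟨ +-cong (total-map (λ _ → refl) (paths n k))
           (+-cong (total-map (λ _ → refl) (paths n (suc k))) (total-map (λ _ → refl) (paths n (suc (suc k))))) ⟩
    M n k x y * 1# + (M n (suc k) x y * y + M n (suc (suc k)) x y * 1#)
      ≈⟨ +-cong (*-identityʳ _) (+-cong (*-comm _ _) (*-identityʳ _)) ⟩
    M n k x y + (y * M n (suc k) x y + M n (suc (suc k)) x y)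
      ≈⟨ +-assoc _ _ _ ⟨
    M n k x y + y * M n (suc k) x y + M n (suc (suc k)) x y ∎
    where
    w : ∀ {n k} → Path n k → Carrier
    w = weight x y

  -- Split the weight of each horizontal step on the axis as e + y. Choosing y throughout gives the
  -- first term. Otherwise turn the last step that chooses e into an up step: it becomes the last
  -- departure from the axis of a path to height k + 1, and all horizontal steps after it have
  -- weight y. The recurrences express this as an induction on n.
  M-diagonal : ∀ {x y e} → x ≈ e + y → ∀ n k →
               M n k x y ≈ M n k y y + e * M n (suc k) x y
  M-diagonal {x} {y} {e} x≈e+y zero zero =
    sym (trans (+-congˡ (zeroʳ e)) (+-identityʳ _))
  M-diagonal {x} {y} {e} x≈e+y zero (suc k) =
    sym (trans (+-congˡ (zeroʳ e)) (+-identityʳ _))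
  M-diagonal {x} {y} {e} x≈e+y (suc n) zero = begin
    M (suc n) 0 x y
      ≈⟨ M-suc-zero n x y ⟩
    x * g 0 + g 1
      ≈⟨ +-congʳ (*-congʳ x≈e+y) ⟩
    (e + y) * g 0 + g 1
      ≈⟨ solve 4 (λ e y g₀ g₁ → (e :+ y) :* g₀ :+ g₁ := (e :* g₀ :+ y :* g₀) :+ g₁) refl e y (g 0) (g 1) ⟩
    e * g 0 + y * g 0 + g 1
      -- The summand `e * g 0` is left unexpanded: it becomes the up-step term of `M (suc n) 1 x y`.
      ≈⟨ +-cong (+-congˡ (*-congˡ (M-diagonal x≈e+y n 0))) (M-diagonal x≈e+y n 1) ⟩
    e * g 0 + y * (d 0 + e * g 1) + (d 1 + e * g 2)
      ≈⟨ solve 7 (λ e y d₀ d₁ g₀ g₁ g₂ →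
           e :* g₀ :+ y :* (d₀ :+ e :* g₁) :+ (d₁ :+ e :* g₂)
             := (y :* d₀ :+ d₁) :+ e :* ((g₀ :+ y :* g₁) :+ g₂))
           refl e y (d 0) (d 1) (g 0) (g 1) (g 2) ⟩
    (y * d 0 + d 1) + e * (g 0 + y * g 1 + g 2)
      ≈⟨ +-cong (M-suc-zero n y y) (*-congˡ (M-suc-suc n 0 x y)) ⟨
    M (suc n) 0 y y + e * M (suc n) 1 x y ∎
    where
    g d : ℕ → Carrier
    g k = M n k x y
    d k = M n k y y
  M-diagonal {x} {y} {e} x≈e+y (suc n) (suc k) = begin
    M (suc n) (suc k) x y
      ≈⟨ M-suc-suc n k x y ⟩
    g 0 + y * g 1 + g 2
      ≈⟨ +-cong (+-cong (ih 0) (*-congˡ (ih 1))) (ih 2) ⟩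
    d 0 + e * g 1 + y * (d 1 + e * g 2) + (d 2 + e * g 3)
      ≈⟨ solve 8 (λ e y d₀ d₁ d₂ g₁ g₂ g₃ →
           (d₀ :+ e :* g₁) :+ y :* (d₁ :+ e :* g₂) :+ (d₂ :+ e :* g₃)
             := (d₀ :+ y :* d₁ :+ d₂) :+ e :* ((g₁ :+ y :* g₂) :+ g₃))
           refl e y (d 0) (d 1) (d 2) (g 1) (g 2) (g 3) ⟩
    (d 0 + y * d 1 + d 2) + e * (g 1 + y * g 2 + g 3)
      ≈⟨ +-cong (M-suc-suc n k y y) (*-congˡ (M-suc-suc n (suc k) x y)) ⟨
    M (suc n) (suc k) y y + e * M (suc n) (suc (suc k)) x y ∎
    where
    g d : ℕ → Carrier
    g j = M n (j ℕ.+ k) x y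
    d j = M n (j ℕ.+ k) y y

    ih : ∀ j → g j ≈ d j + e * g (suc j)
    ih j = M-diagonal x≈e+y n (j ℕ.+ k)

  -- Taking e = 1 in `M-diagonal` makes each summand a difference of consecutive heights; the upper
  -- end vanishes because s + 1 exceeds n.
  ∑-M-diagonal : ∀ y {n s} → n ≤ s → ∑[ k ≤ s ] M n k y y ≈ M n 0 (y + 1#) y
  ∑-M-diagonal y {n} {s} n≤s = begin
    ∑[ k ≤ s ] M n k y y
      ≈⟨ ∑≤-cong s (λ k _ → sym (x≈z+y⇒x-y≈z
           (trans (M-diagonal (+-comm y 1#) n k) (+-congˡ (*-identityˡ _))))) ⟩
    ∑[ k ≤ s ] (M n k (y + 1#) y - M n (suc k) (y + 1#) y)
      ≈⟨ ∑≤-telescope s (λ k → M n k (y + 1#) y) ⟩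
    M n 0 (y + 1#) y - M n (suc s) (y + 1#) y
      ≈⟨ x≈z+y⇒x-y≈z (sym (trans (+-congˡ (M-vanishes _ y (s≤s n≤s))) (+-identityʳ _))) ⟩
    M n 0 (y + 1#) y ∎

  -- Determinants as telescoping differences.

  module _ (x y : Carrier) where

    private
      x≈[x-y]+y : x ≈ (x - y) + y
      x≈[x-y]+y = sym (//-rightDividesˡ y x)

    -- The value at height k - 1, where the value at height -1 is chosen so that
    -- M-suc holds at every height.
    M-below : ℕ → ℕ → Carrier
    M-below n zero    = (x - y) * M n 0 x y
    M-below n (suc k) = M n k x y

    M-suc : ∀ n k → M (suc n) k x y ≈ M-below n k + y * M n k x y + M n (suc k) x y
    M-suc n zero    = begin
      M (suc n) 0 x y                           ≈⟨ M-suc-zero n x y ⟩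
      x * M n 0 x y + M n 1 x y                 ≈⟨ +-congʳ (*-congʳ x≈[x-y]+y) ⟩
      ((x - y) + y) * M n 0 x y + M n 1 x y     ≈⟨ +-congʳ (distribʳ _ _ _) ⟩
      M-below n 0 + y * M n 0 x y + M n 1 x y   ∎
    M-suc n (suc k) = M-suc-suc n k x y

    -- The four lengths are independent, so that the determinant of the theorem and those of the
    -- case r = 0 are both instances.
    det : (p p′ q q′ ℓ k : ℕ) → Carrier
    det p p′ q q′ ℓ k =
      det₂ (M p  k x y) (M q  (suc (k ℕ.+ ℓ)) x y)
           (M p′ k x y) (M q′ (suc (k ℕ.+ ℓ)) x y)

    -- Expand both entries of the lower row by the recurrence. The two products with factor y
    -- cancel, and the other four are those of c k and c (k + 1). The second column has height at
    -- least 1, so only the first column meets the axis, where `M-below` supplies the boundary term.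
    det-adjacent-telescopes : ∀ p q ℓ k →
      let c = λ k → M p k x y * M q (k ℕ.+ ℓ) x y - M-below p k * M q (suc (k ℕ.+ ℓ)) x y
      in det p (suc p) q (suc q) ℓ k ≈ c k - c (suc k)
    det-adjacent-telescopes p q ℓ k = sym (trans ([w-x]-[y-z]≈[w+z]-[x+y] _ _ _ _)
      (x+w≈z+y⇒x-y≈z-w (begin
        f₀ * g₀ + f₀ * g₂ + g₁ * M (suc p) k x y
          ≈⟨ +-congˡ (*-congˡ (M-suc p k)) ⟩
        f₀ * g₀ + f₀ * g₂ + g₁ * (f₋ + y * f₀ + f₁)
          ≈⟨ solve 7 (λ y f₋ f₀ f₁ g₀ g₁ g₂ →
               f₀ :* g₀ :+ f₀ :* g₂ :+ g₁ :* (f₋ :+ y :* f₀ :+ f₁)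
                 := f₀ :* (g₀ :+ y :* g₁ :+ g₂) :+ (f₋ :* g₁ :+ f₁ :* g₁))
               refl y f₋ f₀ f₁ g₀ g₁ g₂ ⟩
        f₀ * (g₀ + y * g₁ + g₂) + (f₋ * g₁ + f₁ * g₁)
          ≈⟨ +-congʳ (*-congˡ (M-suc-suc q (k ℕ.+ ℓ) x y)) ⟨
        f₀ * M (suc q) (suc (k ℕ.+ ℓ)) x y + (f₋ * g₁ + f₁ * g₁) ∎)))
      where
      f₋ = M-below p k
      f₀ = M p k x y
      f₁ = M p (suc k) x y
      g₀ = M q (k ℕ.+ ℓ) x y
      g₁ = M q (suc (k ℕ.+ ℓ)) x y
      g₂ = M q (suc (suc (k ℕ.+ ℓ))) x y

    ∑-det-adjacent : ∀ {p K} q ℓ → p < K →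
                     ∑[ k ≤ K ] det p (suc p) q (suc q) ℓ k ≈ M p 0 x y * M q ℓ y y
    ∑-det-adjacent {p} {K} q ℓ p<K = begin
      ∑[ k ≤ K ] det p (suc p) q (suc q) ℓ k
        ≈⟨ ∑≤-cong K (λ k _ → det-adjacent-telescopes p q ℓ k) ⟩
      ∑[ k ≤ K ] (c k - c (suc k))
        ≈⟨ ∑≤-telescope K c ⟩
      c 0 - c (suc K)
        ≈⟨ x≈z+y⇒x-y≈z (trans c₀ (sym (trans (+-congˡ c-vanishes) (+-identityʳ _)))) ⟩
      M p 0 x y * M q ℓ y y ∎
      where
      c : ℕ → Carrier
      c k = M p k x y * M q (k ℕ.+ ℓ) x y - M-below p k * M q (suc (k ℕ.+ ℓ)) x y

      c₀ : c 0 ≈ M p 0 x y * M q ℓ y y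
      -- With e = x - y, the correction term of `M-diagonal` is exactly what `M-below p 0`
      -- subtracts.
      c₀ = x≈z+y⇒x-y≈z (trans (*-congˡ (M-diagonal x≈[x-y]+y q ℓ))
        (solve 4 (λ e f d g → f :* (d :+ e :* g) := f :* d :+ (e :* f) :* g) refl
          (x - y) (M p 0 x y) (M q ℓ y y) (M q (suc ℓ) x y)))

      c-vanishes : c (suc K) ≈ 0#
      -- `M-below p (suc K)` is `M p K`, so its vanishing takes p < K, not merely p ≤ K.
      c-vanishes = x≈z+y⇒x-y≈z (begin
        M p (suc K) x y * _   ≈⟨ *-congʳ (M-vanishes x y (ℕ.m<n⇒m<1+n p<K)) ⟩
        0# * _                ≈⟨ zeroˡ _ ⟩
        0#                    ≈⟨ zeroˡ _ ⟨
        0# * _                ≈⟨ *-congʳ (M-vanishes x y p<K) ⟨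
        M p K x y * _         ≈⟨ +-identityˡ _ ⟨
        0# + M p K x y * _    ∎)

    -- Move one unit of length at a time from the second factor to the first in the product `c i`.
    -- The ends i = 0 and i = r + 1 are the two products of the determinant, and each move is an
    -- adjacent determinant.
    det≈∑-det-adjacent : ∀ n m r ℓ k → det n (n ℕ.+ suc r) m (suc (m ℕ.+ r)) ℓ k ≈
      ∑[ i ≤ r ] det (n ℕ.+ i) (suc (n ℕ.+ i)) ((m ℕ.+ r) ∸ i) (suc ((m ℕ.+ r) ∸ i)) ℓ k
    det≈∑-det-adjacent n m r ℓ k = sym (begin
      ∑[ i ≤ r ] det (n ℕ.+ i) (suc (n ℕ.+ i)) (s ∸ i) (suc (s ∸ i)) ℓ k
        ≈⟨ ∑≤-cong r (λ i i≤r → +-cong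
             -- Since i ≤ r ≤ m + r, the subtraction is not truncated and commutes with the
             -- successor.
             (*-congˡ {f (n ℕ.+ i)} (reflexive (≡.cong g (≡.sym (ℕ.+-∸-assoc 1 (ℕ.≤-trans i≤r (ℕ.m≤n+m r m)))))))
             (-‿cong (trans (*-comm (g (s ∸ i)) (f (suc (n ℕ.+ i))))
               (*-congʳ (reflexive (≡.cong f (≡.sym (ℕ.+-suc n i)))))))) ⟩
      ∑[ i ≤ r ] (c i - c (suc i))
        ≈⟨ ∑≤-telescope r c ⟩
      f (n ℕ.+ 0) * g (suc s) - f (n ℕ.+ suc r) * g (s ∸ r)
        ≈⟨ +-cong (*-congʳ (reflexive (≡.cong f (ℕ.+-identityʳ n))))
             (-‿cong (trans (*-comm _ _) (*-congʳ (reflexive (≡.cong g (ℕ.m+n∸n≡m m r)))))) ⟩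
      det n (n ℕ.+ suc r) m (suc s) ℓ k ∎)
      where
      s = m ℕ.+ r
      f g c : ℕ → Carrier
      f p = M p k x y
      g q = M q (suc (k ℕ.+ ℓ)) x y
      c i = f (n ℕ.+ i) * g (suc s ∸ i)

    -- Range of summation and the two identities.

    det₂-zeroˡ : ∀ {u v w z} → u ≈ 0# → w ≈ 0# → det₂ u v w z ≈ 0#
    det₂-zeroˡ u≈0 w≈0 = x≈z+y⇒x-y≈z (trans (trans (*-congʳ u≈0) (zeroˡ _))
      (sym (trans (+-identityˡ _) (trans (*-congˡ w≈0) (zeroʳ _)))))

    det₂-zeroʳ : ∀ {u v w z} → v ≈ 0# → z ≈ 0# → det₂ u v w z ≈ 0#
    det₂-zeroʳ v≈0 z≈0 = x≈z+y⇒x-y≈z (trans (trans (*-congˡ z≈0) (zeroʳ _))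
      (sym (trans (+-identityˡ _) (trans (*-congʳ v≈0) (zeroˡ _)))))

    -- Past the bound n + r + 1 the first column is zero, past m + r - ℓ the second: its heights
    -- exceed the lengths of the paths.
    det-vanishes : ∀ n m r ℓ k → N n m r ℓ < k → det n (n ℕ.+ suc r) m (suc (m ℕ.+ r)) ℓ k ≈ 0#
    det-vanishes n m r ℓ k N<k with ℕ.⊓-sel (n ℕ.+ r ℕ.+ 1) ((m ℕ.+ r) ∸ ℓ)
    ... | inj₁ N≡n+r+1 = det₂-zeroˡ (M-vanishes x y (ℕ.≤-<-trans (ℕ.m≤m+n n (suc r)) n+1+r<k))
                                   (M-vanishes x y n+1+r<k)
      where
      n+1+r<k : n ℕ.+ suc r < k
      n+1+r<k = ≡.subst (_< k)
        (≡.trans N≡n+r+1 (≡.trans (ℕ.+-assoc n r 1) (≡.cong (n ℕ.+_) (ℕ.+-comm r 1)))) N<k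
    ... | inj₂ N≡m+r-ℓ = det₂-zeroʳ
        (M-vanishes x y (ℕ.m<n⇒m<1+n (ℕ.≤-<-trans (ℕ.m≤m+n m r) m+r<k+ℓ)))
        (M-vanishes x y (s≤s m+r<k+ℓ))
      where
      m+r<k+ℓ : m ℕ.+ r < k ℕ.+ ℓ
      m+r<k+ℓ = ℕ.≤-<-trans (ℕ.m≤n+m∸n (m ℕ.+ r) ℓ)
        (≡.subst (ℓ ℕ.+ ((m ℕ.+ r) ∸ ℓ) <_) (ℕ.+-comm ℓ k)
          (ℕ.+-monoʳ-< ℓ (≡.subst (_< k) N≡m+r-ℓ N<k)))

    ∑-det : ∀ n m r ℓ →
      (∑[ k ≤ N n m r ℓ ]
         det₂ (M n k x y)               (M m (k ℕ.+ ℓ ℕ.+ 1) x y)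
              (M (n ℕ.+ r ℕ.+ 1) k x y) (M (m ℕ.+ r ℕ.+ 1) (k ℕ.+ ℓ ℕ.+ 1) x y))
      ≈ (∑[ i ≤ r ] (M (n ℕ.+ i) 0 x y * M ((m ℕ.+ r) ∸ i) ℓ y y))
    ∑-det n m r ℓ = begin
      ∑[ k ≤ N n m r ℓ ]
        det₂ (M n k x y)               (M m (k ℕ.+ ℓ ℕ.+ 1) x y)
             (M (n ℕ.+ r ℕ.+ 1) k x y) (M (m ℕ.+ r ℕ.+ 1) (k ℕ.+ ℓ ℕ.+ 1) x y)
        ≈⟨ ∑≤-cong (N n m r ℓ) (λ k _ → reflexive (normalise k)) ⟩
      ∑≤ (N n m r ℓ) (det n (n ℕ.+ suc r) m (suc s) ℓ)
        -- Extending the sum to K = n + r + 1 adds only zeros and puts the limit above every n + i,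
        -- as `∑-det-adjacent` requires.
        ≈⟨ ∑≤-truncate (ℕ.m⊓n≤m K (s ∸ ℓ)) (det-vanishes n m r ℓ) ⟨
      ∑≤ K (det n (n ℕ.+ suc r) m (suc s) ℓ)
        ≈⟨ ∑≤-cong K (λ k _ → det≈∑-det-adjacent n m r ℓ k) ⟩
      ∑[ k ≤ K ] ∑[ i ≤ r ] adjacent i k
        ≈⟨ ∑≤-comm K r (λ k i → adjacent i k) ⟩
      ∑[ i ≤ r ] ∑[ k ≤ K ] adjacent i k
        ≈⟨ ∑≤-cong r (λ i i≤r → ∑-det-adjacent (s ∸ i) ℓ (n+i<K i≤r)) ⟩
      ∑[ i ≤ r ] (M (n ℕ.+ i) 0 x y * M (s ∸ i) ℓ y y) ∎
      where
      s = m ℕ.+ r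
      K = n ℕ.+ r ℕ.+ 1

      adjacent : ℕ → ℕ → Carrier
      adjacent i = det (n ℕ.+ i) (suc (n ℕ.+ i)) (s ∸ i) (suc (s ∸ i)) ℓ

      normalise : ∀ k →
        det₂ (M n k x y) (M m (k ℕ.+ ℓ ℕ.+ 1) x y)
             (M K k x y) (M (s ℕ.+ 1) (k ℕ.+ ℓ ℕ.+ 1) x y)
        ≡ det n (n ℕ.+ suc r) m (suc s) ℓ k
      normalise k
        rewrite ℕ.+-comm (k ℕ.+ ℓ) 1 | ℕ.+-comm s 1 | ℕ.+-comm (n ℕ.+ r) 1 | ℕ.+-suc n r = ≡.refl

      n+i<K : ∀ {i} → i ≤ r → n ℕ.+ i < K
      n+i<K i≤r = ℕ.≤-<-trans (ℕ.+-monoʳ-≤ n i≤r) (ℕ.m<m+n (n ℕ.+ r) (s≤s z≤n))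

    ∑-∑-det : ∀ n m r →
      (∑[ ℓ ≤ m ℕ.+ r ] ∑[ k ≤ N n m r ℓ ]
         det₂ (M n k x y)               (M m (k ℕ.+ ℓ ℕ.+ 1) x y)
              (M (n ℕ.+ r ℕ.+ 1) k x y) (M (m ℕ.+ r ℕ.+ 1) (k ℕ.+ ℓ ℕ.+ 1) x y))
      ≈ (∑[ i ≤ r ] (M (n ℕ.+ i) 0 x y * M ((m ℕ.+ r) ∸ i) 0 (y + 1#) y))
    ∑-∑-det n m r = begin
      _
        ≈⟨ ∑≤-cong s (λ ℓ _ → ∑-det n m r ℓ) ⟩
      ∑[ ℓ ≤ s ] ∑[ i ≤ r ] (M (n ℕ.+ i) 0 x y * M (s ∸ i) ℓ y y)
        ≈⟨ ∑≤-comm s r (λ ℓ i → M (n ℕ.+ i) 0 x y * M (s ∸ i) ℓ y y) ⟩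
      ∑[ i ≤ r ] ∑[ ℓ ≤ s ] (M (n ℕ.+ i) 0 x y * M (s ∸ i) ℓ y y)
        -- The first factor does not depend on ℓ, and the limit s covers every height that a path of
        -- length s - i can reach.
        ≈⟨ ∑≤-cong r (λ i _ → trans
             (sym (*-distribˡ-sum {suc s} (M (n ℕ.+ i) 0 x y) (λ ℓ → M (s ∸ i) (toℕ ℓ) y y)))
             (*-congˡ (∑-M-diagonal y (ℕ.m∸n≤m s i)))) ⟩
      ∑[ i ≤ r ] (M (n ℕ.+ i) 0 x y * M (s ∸ i) 0 (y + 1#) y) ∎
      where
      s = m ℕ.+ r

theorem3p2 : ∀ {a b} (R : CommutativeRing a b) →
    let open CommutativeRing R
        open Motzkin R
    in
    (x y : Carrier) (n r m : ℕ) →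
      ((ℓ : ℕ) → ℓ ≤ m →
        (∑[ k ≤ N n m r ℓ ]
           det₂ (M n k x y)                   (M m (k ℕ.+ ℓ ℕ.+ 1) x y)
                (M (n ℕ.+ r ℕ.+ 1) k x y)     (M (m ℕ.+ r ℕ.+ 1) (k ℕ.+ ℓ ℕ.+ 1) x y))
        ≈ (∑[ i ≤ r ] (M (n ℕ.+ i) 0 x y * M ((m ℕ.+ r) ∸ i) ℓ y y)))
      ×
      ((∑[ ℓ ≤ m ℕ.+ r ] ∑[ k ≤ N n m r ℓ ]
          det₂ (M n k x y)                   (M m (k ℕ.+ ℓ ℕ.+ 1) x y)
               (M (n ℕ.+ r ℕ.+ 1) k x y)     (M (m ℕ.+ r ℕ.+ 1) (k ℕ.+ ℓ ℕ.+ 1) x y))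
       ≈ (∑[ i ≤ r ] (M (n ℕ.+ i) 0 x y * M ((m ℕ.+ r) ∸ i) 0 (y + 1#) y)))
theorem3p2 R x y n r m = (λ ℓ _ → ∑-det x y n m r ℓ) , ∑-∑-det x y n m r
  where open MotzkinProperties R
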